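{- Define integers $A''(n)$, $n\ge1$, by \[ \sum_{n=1}^\infty A''(n) q^n := \sum_{n=1}^\infty q^{n}(-q^{n+1};q)_\infty^2 (q^{n+1};q)_\infty (q^{n};q)_{n}. \] Then \[ \sum_{n=1}^\infty q^{n}(-q^{n+1};q)_\infty^2 (q^{n+1};q)_\infty (q^{n};q)_{n} = \sum_{n=1}^\infty n\, q^{\frac{n(n+1)}{2}}. \]
   Context: Here $q$ is a complex number with $|q|<1$ (equivalently, identities of formal power series in $q$). Notation: $(a;q)_0=1$, $(a;q)_n=\prod_{j=0}^{n-1}(1-aq^j)$, $(a;q)_\infty=\prod_{j=0}^{\infty}(1-aq^j)$, and $(a;q)_\infty^k$ denotes the $k$-th power of $(a;q)_\infty$. -}

module Defs where

open import Data.Nat using (ℕ; zero; suc; _∸_)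
open import Data.Integer using (ℤ; +_; -_; _+_; _*_; _-_)

-- Formal power series in q with integer coefficients: n ↦ coefficient of q^n.
FPS : Set
FPS = ℕ → ℤ

sumUpTo : ℕ → (ℕ → ℤ) → ℤ
sumUpTo zero    f = f 0
sumUpTo (suc m) f = sumUpTo m f + f (suc m)

one : FPS
one zero    = + 1
one (suc _) = + 0

shift : ℕ → FPS → FPS
shift zero    f       = f
shift (suc j) f zero    = + 0
shift (suc j) f (suc m) = shift j f m

qpow : ℕ → FPS
qpow k = shift k one

infixl 6 _⊕_ _⊖_
infixl 7 _⊛_ _•_

_⊕_ : FPS → FPS → FPS
(f ⊕ g) m = f m + g m

_⊖_ : FPS → FPS → FPS
(f ⊖ g) m = f m - g m

neg : FPS → FPS
neg f m = - f m

_•_ : ℤ → FPS → FPS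
(c • f) m = c * f m

_⊛_ : FPS → FPS → FPS
(f ⊛ g) m = sumUpTo m (λ i → f i * g (m ∸ i))

poch : FPS → ℕ → FPS
poch a zero    = one
poch a (suc n) = poch a n ⊛ (one ⊖ shift n a)

-- infinite q-Pochhammer (a;q)_∞ for a series a with zero constant term:
-- the coefficient of q^m equals that of the finite product over j ≤ m,
-- since the factors with j > m are ≡ 1 modulo q^(m+1).
pochInf : FPS → FPS
pochInf a m = poch a (suc m) m

-- Infinite sum Σ_{n≥1} T n of series where T n has order ≥ n
-- (only the terms n ≤ m+1 can contribute to the coefficient of q^m).
sumInf : (ℕ → FPS) → FPS
sumInf T m = sumUpTo m (λ i → T (suc i) m)

tri : ℕ → ℕ
tri zero    = zero
tri (suc n) = suc n Data.Nat.+ tri n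

lhsTerm : ℕ → FPS
lhsTerm n =
  qpow n ⊛ pochInf (neg (qpow (suc n))) ⊛ pochInf (neg (qpow (suc n)))
         ⊛ pochInf (qpow (suc n)) ⊛ poch (qpow n) n

A''-series : FPS
A''-series = sumInf lhsTerm

A'' : ℕ → ℤ
A'' n = A''-series n

rhsSeries : FPS
rhsSeries = sumInf (λ n → (+ n) • qpow (tri n))

{-# OPTIONS --safe #-}
module Submission where

-- Truncating the infinite products at q^n gives the polynomials
--   S_n = Σ_{1≤j≤n} q^j (-q^{j+1};q)²_{n-j} (q^{j+1};q)_{n-j} (q^j;q)_j,
-- which have the closed form
--   S_n = (q;q)_n Σ_{k≤n} k q^{k(k+1)/2} [2n+1 choose n+k+1]_q.
-- Both sides satisfy the same first-order recurrence in n: on the right, two q-Pascal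
-- rules turn the coefficient at (n+1, k) into a combination of those at (n, k-1), (n, k),
-- (n, k+1), and since 2k = (k-1) + (k+1) the weighted sum reproduces itself up to a k = 0
-- boundary term, which is exactly the new summand q^{n+1} (q^{n+1};q)_{n+1}.
-- Finally (q;q)_n [2n+1 choose n+k+1]_q ≡ 1 mod q^{n-k+1}, so S_n ≡ Σ_{k≤n} k q^{k(k+1)/2}
-- mod q^{n+1}.

open import Defs
open import Data.Nat as ℕ using (ℕ; zero; suc; _∸_; _≤_; _<_; z≤n; s≤s)
import Data.Nat.Properties as ℕ
import Data.Nat.Tactic.RingSolver as NatSolver
open import Data.Integer using (ℤ; +_; -[1+_]; -_; _+_; _*_; _-_)
import Data.Integer.Properties as ℤ
open import Data.Integer.Solver using (module +-*-Solver)
import Data.Maybe as Maybe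
open import Data.Product using (_,_)
open import Function using (_∘_)
open import Level using (0ℓ)
open import Algebra.Bundles using (CommutativeRing)
import Algebra.Solver.Ring
open import Algebra.Solver.Ring.AlmostCommutativeRing
  using (fromCommutativeRing; _-Raw-AlmostCommutative⟶_)
open import Relation.Binary.PropositionalEquality
  using (_≡_; refl; sym; trans; cong; cong₂; subst; module ≡-Reasoning)
import Relation.Binary.Reasoning.Setoid as SetoidReasoning
open import Relation.Nullary using (yes; no)
open import Relation.Nullary.Decidable.Core using (dec⇒maybe)

-- Finite sums of integers

sumUpTo-cong : ∀ m {f g : ℕ → ℤ} → (∀ i → i ≤ m → f i ≡ g i) → sumUpTo m f ≡ sumUpTo m g
sumUpTo-cong zero    h = h 0 z≤n
sumUpTo-cong (suc m) h =
  cong₂ _+_ (sumUpTo-cong m λ i i≤m → h i (ℕ.m≤n⇒m≤1+n i≤m)) (h (suc m) ℕ.≤-refl)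

sumUpTo-+ : ∀ m (f g : ℕ → ℤ) → sumUpTo m (λ i → f i + g i) ≡ sumUpTo m f + sumUpTo m g
sumUpTo-+ zero    f g = refl
sumUpTo-+ (suc m) f g rewrite sumUpTo-+ m f g =
  solve 4 (λ a b c d → a :+ b :+ (c :+ d) := a :+ c :+ (b :+ d)) refl
    (sumUpTo m f) (sumUpTo m g) (f (suc m)) (g (suc m))
  where open +-*-Solver

sumUpTo-* : ∀ m c (f : ℕ → ℤ) → sumUpTo m (λ i → c * f i) ≡ c * sumUpTo m f
sumUpTo-* zero    c f = refl
sumUpTo-* (suc m) c f rewrite sumUpTo-* m c f = sym (ℤ.*-distribˡ-+ c _ _)

sumUpTo-first : ∀ m (f : ℕ → ℤ) → sumUpTo (suc m) f ≡ f 0 + sumUpTo m (f ∘ suc)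
sumUpTo-first zero    f = refl
sumUpTo-first (suc m) f rewrite sumUpTo-first m f = ℤ.+-assoc (f 0) _ _

-- The ring of formal power series

infix 4 _≈_ _≈[_]_

-- Being a record, the relation keeps `f` and `g` visible to unification; bare pointwise equality
-- would unfold the operations and lose them.
record _≈_ (f g : FPS) : Set where
  constructor coeffwise
  field coeff : ∀ m → f m ≡ g m
open _≈_

-- Congruence modulo q^d.
record _≈[_]_ (f : FPS) (d : ℕ) (g : FPS) : Set where
  constructor below
  field coeff< : ∀ m → m < d → f m ≡ g m
open _≈[_]_

0s : FPS
0s _ = + 0

-- This is f = f(0) + q f′ with f′ = `f ∘ suc`, multiplied by g. It drives the inductions on the
-- coefficient index below.
⊛-suc : ∀ f g m → (f ⊛ g) (suc m) ≡ f 0 * g (suc m) + ((f ∘ suc) ⊛ g) m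
⊛-suc f g m = sumUpTo-first m (λ i → f i * g (suc m ∸ i))

⊛-sucʳ : ∀ f g m → (f ⊛ g) (suc m) ≡ (f ⊛ (g ∘ suc)) m + f (suc m) * g 0
⊛-sucʳ f g m = cong₂ _+_
  (sumUpTo-cong m λ i i≤m → cong (λ j → f i * g j) (ℕ.+-∸-assoc 1 i≤m))
  (cong (λ j → f (suc m) * g j) (ℕ.n∸n≡0 m))

⊛-congᵐ : ∀ {d f f′ g g′} → f ≈[ d ] f′ → g ≈[ d ] g′ → f ⊛ g ≈[ d ] f′ ⊛ g′
⊛-congᵐ (below p) (below r) = below λ m m<d → sumUpTo-cong m λ i i≤m →
  cong₂ _*_ (p i (ℕ.≤-<-trans i≤m m<d)) (r (m ∸ i) (ℕ.≤-<-trans (ℕ.m∸n≤m m i) m<d))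

⊛-cong : ∀ {f f′ g g′} → f ≈ f′ → g ≈ g′ → f ⊛ g ≈ f′ ⊛ g′
⊛-cong (coeffwise p) (coeffwise r) = coeffwise λ m → sumUpTo-cong m λ i _ →
  cong₂ _*_ (p i) (r (m ∸ i))

-- Peeling the first term off one convolution matches peeling the last term off the other. The
-- series vary in the induction, since the hypothesis is applied to `f ∘ suc`.
⊛-comm-coeff : ∀ m f g → (f ⊛ g) m ≡ (g ⊛ f) m
⊛-comm-coeff zero    f g = ℤ.*-comm (f 0) (g 0)
⊛-comm-coeff (suc m) f g = begin
  (f ⊛ g) (suc m)                         ≡⟨ ⊛-suc f g m ⟩
  f 0 * g (suc m) + ((f ∘ suc) ⊛ g) m     ≡⟨ cong₂ _+_ (ℤ.*-comm (f 0) _)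
      (⊛-comm-coeff m (f ∘ suc) g) ⟩
  g (suc m) * f 0 + (g ⊛ (f ∘ suc)) m     ≡⟨ ℤ.+-comm (g (suc m) * f 0) _ ⟩
  (g ⊛ (f ∘ suc)) m + g (suc m) * f 0     ≡⟨ ⊛-sucʳ g f m ⟨
  (g ⊛ f) (suc m)                         ∎
  where open ≡-Reasoning

⊛-distribʳ-coeff : ∀ h f g m → ((f ⊕ g) ⊛ h) m ≡ (f ⊛ h) m + (g ⊛ h) m
⊛-distribʳ-coeff h f g m = trans
  (sumUpTo-cong m λ i _ → ℤ.*-distribʳ-+ (h (m ∸ i)) (f i) (g i))
  (sumUpTo-+ m _ _)

•-⊛-coeff : ∀ c f g m → ((c • f) ⊛ g) m ≡ c * (f ⊛ g) m
•-⊛-coeff c f g m = trans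
  (sumUpTo-cong m λ i _ → ℤ.*-assoc c (f i) (g (m ∸ i)))
  (sumUpTo-* m c _)

-- By `⊛-suc`, the shifted product `(f ⊛ g) ∘ suc` is `(f 0 • (g ∘ suc)) ⊕ ((f ∘ suc) ⊛ g)`.
-- Distributivity then leaves a triple product headed by `f ∘ suc` at a smaller index.
⊛-assoc-coeff : ∀ m f g h → ((f ⊛ g) ⊛ h) m ≡ (f ⊛ (g ⊛ h)) m
⊛-assoc-coeff zero    f g h = ℤ.*-assoc (f 0) (g 0) (h 0)
⊛-assoc-coeff (suc m) f g h = begin
  ((f ⊛ g) ⊛ h) (suc m)
    ≡⟨ ⊛-suc (f ⊛ g) h m ⟩
  a * b * c + (((f ⊛ g) ∘ suc) ⊛ h) m
    ≡⟨ cong (λ x → a * b * c + x)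
        (coeff (⊛-cong {g = h} (coeffwise (⊛-suc f g)) (coeffwise λ _ → refl)) m) ⟩
  a * b * c + (((a • (g ∘ suc)) ⊕ ((f ∘ suc) ⊛ g)) ⊛ h) m
    ≡⟨ cong (λ x → a * b * c + x) (⊛-distribʳ-coeff h (a • (g ∘ suc)) ((f ∘ suc) ⊛ g) m) ⟩
  a * b * c + (((a • (g ∘ suc)) ⊛ h) m + (((f ∘ suc) ⊛ g) ⊛ h) m)
    ≡⟨ cong₂ (λ x y → a * b * c + (x + y)) (•-⊛-coeff a (g ∘ suc) h m)
        (⊛-assoc-coeff m (f ∘ suc) g h) ⟩
  a * b * c + (a * ((g ∘ suc) ⊛ h) m + ((f ∘ suc) ⊛ (g ⊛ h)) m)
    ≡⟨ solve 5 (λ a b c x y → a :* b :* c :+ (a :* x :+ y) := a :* (b :* c :+ x) :+ y) refl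
         a b c (((g ∘ suc) ⊛ h) m) (((f ∘ suc) ⊛ (g ⊛ h)) m) ⟩
  a * (b * c + ((g ∘ suc) ⊛ h) m) + ((f ∘ suc) ⊛ (g ⊛ h)) m
    ≡⟨ cong (λ x → a * x + ((f ∘ suc) ⊛ (g ⊛ h)) m) (⊛-suc g h m) ⟨
  a * (g ⊛ h) (suc m) + ((f ∘ suc) ⊛ (g ⊛ h)) m
    ≡⟨ ⊛-suc f (g ⊛ h) m ⟨
  (f ⊛ (g ⊛ h)) (suc m) ∎
  where
  open ≡-Reasoning
  open +-*-Solver
  a = f 0
  b = g 0
  c = h (suc m)

0s⊛-coeff : ∀ f m → (0s ⊛ f) m ≡ + 0
0s⊛-coeff f zero    = refl
0s⊛-coeff f (suc m) = trans (⊛-suc 0s f m) (trans (ℤ.+-identityˡ _) (0s⊛-coeff f m))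

one⊛-coeff : ∀ f m → (one ⊛ f) m ≡ f m
one⊛-coeff f zero    = ℤ.*-identityˡ (f 0)
one⊛-coeff f (suc m) = trans (⊛-suc one f m)
  (trans (cong₂ _+_ (ℤ.*-identityˡ (f (suc m))) (0s⊛-coeff f m)) (ℤ.+-identityʳ _))

FPS-commutativeRing : CommutativeRing 0ℓ 0ℓ
FPS-commutativeRing = record
  { Carrier = FPS ; _≈_ = _≈_ ; _+_ = _⊕_ ; _*_ = _⊛_ ; -_ = neg ; 0# = 0s ; 1# = one
  ; isCommutativeRing = record
    { isRing = record
      { +-isAbelianGroup = record
        { isGroup = record
          { isMonoid = record
            { isSemigroup = record
              { isMagma = record
                { isEquivalence = record
                  { refl  = coeffwise λ _ → refl
                  ; sym   = λ (coeffwise p) → coeffwise λ m → sym (p m)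
                  ; trans = λ (coeffwise p) (coeffwise r) → coeffwise λ m → trans (p m) (r m) }
                ; ∙-cong = λ (coeffwise p) (coeffwise r) → coeffwise λ m → cong₂ _+_ (p m) (r m) }
              ; assoc = λ f g h → coeffwise λ m → ℤ.+-assoc (f m) (g m) (h m) }
            ; identity = (λ f → coeffwise λ m → ℤ.+-identityˡ (f m))
                       , (λ f → coeffwise λ m → ℤ.+-identityʳ (f m)) }
          ; inverse = (λ f → coeffwise λ m → ℤ.+-inverseˡ (f m))
                    , (λ f → coeffwise λ m → ℤ.+-inverseʳ (f m))
          ; ⁻¹-cong = λ (coeffwise p) → coeffwise λ m → cong -_ (p m) }
        ; comm = λ f g → coeffwise λ m → ℤ.+-comm (f m) (g m) }
      ; *-cong = ⊛-cong
      ; *-assoc = λ f g h → coeffwise λ m → ⊛-assoc-coeff m f g h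
      ; *-identity = ⊛-identityˡ
                   , (λ f → coeffwise λ m → trans (⊛-comm-coeff m f one)
                       (coeff (⊛-identityˡ f) m))
      ; distrib = (λ h f g → coeffwise λ m → trans (⊛-comm-coeff m h (f ⊕ g))
                     (trans (⊛-distribʳ-coeff h f g m)
                            (cong₂ _+_ (⊛-comm-coeff m f h) (⊛-comm-coeff m g h))))
                , (λ h f g → coeffwise λ m → ⊛-distribʳ-coeff h f g m) }
    ; *-comm = λ f g → coeffwise λ m → ⊛-comm-coeff m f g } }
  where
  ⊛-identityˡ : ∀ f → one ⊛ f ≈ f
  ⊛-identityˡ f = coeffwise (one⊛-coeff f)

open CommutativeRing FPS-commutativeRing
  using ( setoid; +-cong; +-congˡ; +-congʳ; +-identityˡ; -‿cong
        ; *-congˡ; *-congʳ; *-assoc; *-identityˡ; *-identityʳ; zeroʳ; distribˡ )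
  renaming (refl to ≈-refl; sym to ≈-sym; trans to ≈-trans; reflexive to ≈-reflexive)

-- Integer constants and the ring solver

-- The clauses for 0 and 1 make the solver's constants unfold to 0s and one.
const : ℤ → FPS
const (+ 0) = 0s
const (+ 1) = one
const c     = c • one

const-coeff : ∀ c m → const c m ≡ c * one m
const-coeff (+ 0)           m = refl
const-coeff (+ 1)           m = sym (ℤ.*-identityˡ (one m))
const-coeff (+ suc (suc n)) m = refl
const-coeff -[1+ n ]        m = refl

const⊛ : ∀ c f → const c ⊛ f ≈ c • f
const⊛ c f = coeffwise λ m → trans (coeff (⊛-cong {g = f} (coeffwise (const-coeff c)) ≈-refl) m)
  (trans (•-⊛-coeff c one f m) (cong (c *_) (one⊛-coeff f m)))

const-homomorphism :
  CommutativeRing.rawRing ℤ.+-*-commutativeRing -Raw-AlmostCommutative⟶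
  fromCommutativeRing FPS-commutativeRing
const-homomorphism = record
  { ⟦_⟧    = const
  ; +-homo = λ x y → coeffwise λ m → trans (const-coeff (x + y) m)
      (trans (ℤ.*-distribʳ-+ (one m) x y)
        (cong₂ _+_ (sym (const-coeff x m)) (sym (const-coeff y m))))
  ; *-homo = λ x y → coeffwise λ m → trans (const-coeff (x * y) m)
      (trans (ℤ.*-assoc x y (one m))
        (trans (cong (x *_) (sym (const-coeff y m))) (sym (coeff (const⊛ x (const y)) m))))
  ; -‿homo = λ x → coeffwise λ m → trans (const-coeff (- x) m)
      (trans (sym (ℤ.neg-distribˡ-* x (one m))) (cong -_ (sym (const-coeff x m))))
  ; 0-homo = ≈-refl
  ; 1-homo = ≈-refl }

-- Solver coefficients are integers embedded by `const`: equality of integers is decidable, so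
-- normal forms can be compared.
module FPS-Solver = Algebra.Solver.Ring _ _ const-homomorphism
  (λ x y → Maybe.map (λ eq → ≈-reflexive (cong const eq)) (dec⇒maybe (x ℤ.≟ y)))

open FPS-Solver using (solve; _:=_; _:+_; _:*_; _:-_; :-_; con)
open SetoidReasoning setoid

-- Shifts and powers of q

shift-cong : ∀ j {f g} → f ≈ g → shift j f ≈ shift j g
shift-cong zero    p = p
shift-cong (suc j) {f} {g} p = coeffwise λ where
  zero    → refl
  (suc m) → coeff (shift-cong j p) m

shift-shift : ∀ i j f → shift i (shift j f) ≈ shift (i ℕ.+ j) f
shift-shift zero    j f = ≈-refl
shift-shift (suc i) j f = coeffwise λ where
  zero    → refl
  (suc m) → coeff (shift-shift i j f) m

shift-neg : ∀ j f → shift j (neg f) ≈ neg (shift j f)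
shift-neg zero    f = ≈-refl
shift-neg (suc j) f = coeffwise λ where
  zero    → refl
  (suc m) → coeff (shift-neg j f) m

shift-congᵐ : ∀ j {d f g} → f ≈[ d ] g → shift j f ≈[ j ℕ.+ d ] shift j g
shift-congᵐ zero    p = p
shift-congᵐ (suc j) {f = f} {g} p = below λ where
  zero    _         → refl
  (suc m) (s≤s m<d) → coeff< (shift-congᵐ j {f = f} {g} p) m m<d

shift-small : ∀ j f → shift j f ≈[ j ] 0s
shift-small zero    f = below λ _ ()
shift-small (suc j) f = below λ where
  zero    _         → refl
  (suc m) (s≤s m<j) → coeff< (shift-small j f) m m<j

qpow⊛ : ∀ j f → qpow j ⊛ f ≈ shift j f
qpow⊛ zero    f = *-identityˡ f
qpow⊛ (suc j) f = coeffwise λ where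
  zero    → refl
  (suc m) → trans (⊛-suc (qpow (suc j)) f m) (trans (ℤ.+-identityˡ _) (coeff (qpow⊛ j f) m))

qpow-+ : ∀ i j → qpow (i ℕ.+ j) ≈ qpow i ⊛ qpow j
qpow-+ i j = ≈-sym (≈-trans (qpow⊛ i (qpow j)) (shift-shift i j one))

≡-qpow : ∀ {i j} → i ≡ j → qpow i ≈ qpow j
≡-qpow eq = ≈-reflexive (cong qpow eq)

-- Finite q-Pochhammer products

poch-cong : ∀ {a b} n → a ≈ b → poch a n ≈ poch b n
poch-cong zero    p = ≈-refl
poch-cong {a} {b} (suc n) p = ⊛-cong (poch-cong n p) (+-congˡ {one} (-‿cong (shift-cong n p)))

poch-+ : ∀ a m n → poch a (m ℕ.+ n) ≈ poch a m ⊛ poch (shift m a) n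
poch-+ a m zero rewrite ℕ.+-identityʳ m = ≈-sym (*-identityʳ (poch a m))
poch-+ a m (suc n) rewrite ℕ.+-suc m n = begin
  poch a (m ℕ.+ n) ⊛ (one ⊖ shift (m ℕ.+ n) a)
    ≈⟨ ⊛-cong (poch-+ a m n) (+-congˡ {one}
        (-‿cong (≈-trans (≈-reflexive (cong (λ k → shift k a) (ℕ.+-comm m n)))
        (≈-sym (shift-shift n m a))))) ⟩
  poch a m ⊛ poch (shift m a) n ⊛ (one ⊖ shift n (shift m a))
    ≈⟨ *-assoc (poch a m) (poch (shift m a) n) (one ⊖ shift n (shift m a)) ⟩
  poch a m ⊛ poch (shift m a) (suc n) ∎

poch-first : ∀ a n → poch a (suc n) ≈ (one ⊖ a) ⊛ poch (shift 1 a) n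
poch-first a n = ≈-trans (poch-+ a 1 n) (*-congʳ {poch (shift 1 a) n} (*-identityˡ (one ⊖ a)))

poch-qpow-first : ∀ k n → poch (qpow k) (suc n) ≈ (one ⊖ qpow k) ⊛ poch (qpow (suc k)) n
poch-qpow-first k n = ≈-trans (poch-first (qpow k) n)
  (*-congˡ {one ⊖ qpow k} (poch-cong n (shift-shift 1 k one)))

-- Congruences modulo q^d and infinite products

≈⇒≈[] : ∀ {d f g} → f ≈ g → f ≈[ d ] g
≈⇒≈[] (coeffwise p) = below λ m _ → p m

≈[]-trans : ∀ {d f g h} → f ≈[ d ] g → g ≈[ d ] h → f ≈[ d ] h
≈[]-trans (below p) (below r) = below λ m m<d → trans (p m m<d) (r m m<d)

≈[]-weaken : ∀ {d e f g} → d ≤ e → f ≈[ e ] g → f ≈[ d ] g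
≈[]-weaken d≤e (below p) = below λ m m<d → p m (ℕ.<-≤-trans m<d d≤e)

⊛-congˡᵐ : ∀ f {d g h} → g ≈[ d ] h → f ⊛ g ≈[ d ] f ⊛ h
⊛-congˡᵐ f = ⊛-congᵐ {f = f} (≈⇒≈[] ≈-refl)

one⊖-small : ∀ {d a} → a ≈[ d ] 0s → one ⊖ a ≈[ d ] one
one⊖-small (below p) = below λ m m<d →
  trans (cong (λ x → one m - x) (p m m<d)) (ℤ.+-identityʳ (one m))

⊛-one : ∀ {d f g} → f ≈[ d ] one → g ≈[ d ] one → f ⊛ g ≈[ d ] one
⊛-one p r = ≈[]-trans (⊛-congᵐ p r) (≈⇒≈[] (*-identityˡ one))

shift-0s : ∀ j {d a} → a ≈[ d ] 0s → shift j a ≈[ d ] 0s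
shift-0s j {d} {a} p = ≈[]-weaken (ℕ.m≤n+m d j)
  (≈[]-trans (shift-congᵐ j p) (≈⇒≈[] (shift-zero j)))
  where
  shift-zero : ∀ j → shift j 0s ≈ 0s
  shift-zero zero    = ≈-refl
  shift-zero (suc j) = coeffwise λ where
    zero    → refl
    (suc m) → coeff (shift-zero j) m

poch-one : ∀ {d a} n → a ≈[ d ] 0s → poch a n ≈[ d ] one
poch-one zero    p = ≈⇒≈[] ≈-refl
poch-one (suc n) p = ⊛-one (poch-one n p) (one⊖-small (shift-0s n p))

-- The k additional factors subtract from 1 a multiple of q^n, so each of them is 1 modulo q^n.
poch-stable : ∀ a n k → poch a (k ℕ.+ n) ≈[ n ] poch a n
poch-stable a n k rewrite ℕ.+-comm k n = ≈[]-trans (≈⇒≈[] (poch-+ a n k))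
  (≈[]-trans (⊛-congˡᵐ (poch a n) (poch-one k (shift-small n a)))
             (≈⇒≈[] (*-identityʳ (poch a n))))

pochInf≈[]poch : ∀ a n → pochInf a ≈[ n ] poch a n
pochInf≈[]poch a n = below λ m m<n →
  trans (sym (coeff< (poch-stable a (suc m) (n ∸ suc m)) m ℕ.≤-refl))
        (cong (λ k → poch a k m) (ℕ.m∸n+n≡m m<n))

pochInf-cong : ∀ {a b} → a ≈ b → pochInf a ≈ pochInf b
pochInf-cong p = coeffwise λ m → coeff (poch-cong (suc m) p) m

pochInf-one : ∀ {d a} → a ≈[ d ] 0s → pochInf a ≈[ d ] one
pochInf-one p = below λ m → coeff< (poch-one (suc m) p) m

pochInf-first : ∀ a → pochInf a ≈ (one ⊖ a) ⊛ pochInf (shift 1 a)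
pochInf-first a = coeffwise λ m →
  -- Coefficient m is read off m+2 factors on the left and m+1 on the right, so that splitting off
  -- the first factor matches the two truncations exactly.
  trans (coeff< (pochInf≈[]poch a (2 ℕ.+ m)) m (s≤s (ℕ.n≤1+n m)))
  (trans (coeff (poch-first a (suc m)) m)
    (sym (coeff< (⊛-congˡᵐ (one ⊖ a) (pochInf≈[]poch (shift 1 a) (suc m))) m ℕ.≤-refl)))

-- Gaussian binomial coefficients

-- The Gaussian binomial coefficient [m choose t]_q.
qbin : ℕ → ℕ → FPS
qbin m       zero    = one
qbin zero    (suc t) = 0s
qbin (suc m) (suc t) = qbin m t ⊕ qpow (suc t) ⊛ qbin m (suc t)

qbin-above : ∀ {m t} → m < t → qbin m t ≈ 0s
qbin-above {zero}  {suc t} _         = ≈-refl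
qbin-above {suc m} {suc t} (s≤s m<t) = begin
  qbin m t ⊕ qpow (suc t) ⊛ qbin m (suc t)
    ≈⟨ +-cong (qbin-above m<t) (*-congˡ {qpow (suc t)} (qbin-above (ℕ.m≤n⇒m≤1+n m<t))) ⟩
  0s ⊕ qpow (suc t) ⊛ 0s
    ≈⟨ ≈-trans (+-identityˡ _) (zeroʳ (qpow (suc t))) ⟩
  0s ∎

-- For t > m both sides vanish, so the exponents may involve truncated differences such as m ∸ t.
qpow-exchange : ∀ a b c d m t → (t ≤ m → a ℕ.+ b ≡ c ℕ.+ d) →
  qpow a ⊛ (qpow b ⊛ qbin m t) ≈ qpow c ⊛ (qpow d ⊛ qbin m t)
qpow-exchange a b c d m t eq with t ℕ.≤? m
... | yes t≤m = begin
  qpow a ⊛ (qpow b ⊛ qbin m t)  ≈⟨ *-assoc (qpow a) (qpow b) (qbin m t) ⟨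
  qpow a ⊛ qpow b ⊛ qbin m t    ≈⟨ *-congʳ {qbin m t} (qpow-+ a b) ⟨
  qpow (a ℕ.+ b) ⊛ qbin m t     ≈⟨ *-congʳ {qbin m t} (≡-qpow (eq t≤m)) ⟩
  qpow (c ℕ.+ d) ⊛ qbin m t     ≈⟨ *-congʳ {qbin m t} (qpow-+ c d) ⟩
  qpow c ⊛ qpow d ⊛ qbin m t    ≈⟨ *-assoc (qpow c) (qpow d) (qbin m t) ⟩
  qpow c ⊛ (qpow d ⊛ qbin m t)  ∎
... | no t≰m = ≈-trans (vanish a b) (≈-sym (vanish c d))
  where
  vanish : ∀ a b → qpow a ⊛ (qpow b ⊛ qbin m t) ≈ 0s
  vanish a b = begin
    qpow a ⊛ (qpow b ⊛ qbin m t)  ≈⟨ *-congˡ {qpow a}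
        (*-congˡ {qpow b} (qbin-above (ℕ.≰⇒> t≰m))) ⟩
    qpow a ⊛ (qpow b ⊛ 0s)        ≈⟨ *-congˡ {qpow a} (zeroʳ (qpow b)) ⟩
    qpow a ⊛ 0s                   ≈⟨ zeroʳ (qpow a) ⟩
    0s ∎

-- The mirror image of the defining q-Pascal rule. Applying the induction hypothesis to both terms
-- of that rule and regrouping works because the middle exponents agree: (t+2) + (m-t-1) = (m-t) +
-- (t+1).
qbin-pascal′ : ∀ m t → qbin (suc m) (suc t) ≈ qpow (m ∸ t) ⊛ qbin m t ⊕ qbin m (suc t)
qbin-pascal′ zero zero = solve 2 (λ x y → con (+ 1) :+ x :* con (+ 0) :=
    con (+ 1) :* con (+ 1) :+ con (+ 0)) ≈-refl (qpow 1) one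
qbin-pascal′ zero (suc t) = solve 1 (λ x → con (+ 0) :+ x :* con (+ 0) :=
    con (+ 1) :* con (+ 0) :+ con (+ 0)) ≈-refl (qpow (suc (suc t)))
qbin-pascal′ (suc m) zero = begin
  one ⊕ qpow 1 ⊛ qbin (suc m) 1
    ≈⟨ +-congˡ {one} (*-congˡ {qpow 1} (qbin-pascal′ m 0)) ⟩
  one ⊕ qpow 1 ⊛ (qpow m ⊛ one ⊕ qbin m 1)
    ≈⟨ solve 3 (λ x y z → con (+ 1) :+ x :* (y :* con (+ 1) :+ z) :=
        x :* y :* con (+ 1) :+ (con (+ 1) :+ x :* z)) ≈-refl (qpow 1) (qpow m) (qbin m 1) ⟩
  qpow 1 ⊛ qpow m ⊛ one ⊕ (one ⊕ qpow 1 ⊛ qbin m 1)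
    ≈⟨ +-congʳ {one ⊕ qpow 1 ⊛ qbin m 1} (*-congʳ {one} (qpow-+ 1 m)) ⟨
  qpow (suc m) ⊛ one ⊕ qbin (suc m) 1 ∎
qbin-pascal′ (suc m) (suc t) = begin
  qbin (suc m) (suc t) ⊕ Q ⊛ qbin (suc m) (suc (suc t))
    ≈⟨ +-cong (qbin-pascal′ m t) (*-congˡ {Q} (qbin-pascal′ m (suc t))) ⟩
  (A ⊛ qbin m t ⊕ qbin m (suc t)) ⊕ Q ⊛ (B ⊛ qbin m (suc t) ⊕ qbin m (suc (suc t)))
    ≈⟨ solve 6 (λ a b q x y z → (a :* x :+ y) :+ q :* (b :* y :+ z) :=
        (a :* x :+ q :* (b :* y)) :+ (y :+ q :* z))
        ≈-refl A B Q (qbin m t) (qbin m (suc t)) (qbin m (suc (suc t))) ⟩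
  (A ⊛ qbin m t ⊕ Q ⊛ (B ⊛ qbin m (suc t))) ⊕ qbin (suc m) (suc (suc t))
    ≈⟨ +-congʳ {qbin (suc m) (suc (suc t))}
        (+-congˡ {A ⊛ qbin m t} (qpow-exchange (suc (suc t)) (m ∸ suc t) (m ∸ t) (suc t) m (suc t)
        exponents)) ⟩
  (A ⊛ qbin m t ⊕ A ⊛ (qpow (suc t) ⊛ qbin m (suc t))) ⊕ qbin (suc m) (suc (suc t))
    ≈⟨ +-congʳ {qbin (suc m) (suc (suc t))}
        (solve 4 (λ a x q y → a :* x :+ a :* (q :* y) := a :* (x :+ q :* y))
        ≈-refl A (qbin m t) (qpow (suc t)) (qbin m (suc t))) ⟩
  A ⊛ qbin (suc m) (suc t) ⊕ qbin (suc m) (suc (suc t)) ∎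
  where
  A = qpow (m ∸ t)
  B = qpow (m ∸ suc t)
  Q = qpow (suc (suc t))
  exponents : suc t ≤ m → suc (suc t) ℕ.+ (m ∸ suc t) ≡ (m ∸ t) ℕ.+ suc t
  exponents t<m = trans (cong suc (ℕ.m+[n∸m]≡n t<m))
    (sym (trans (ℕ.+-suc (m ∸ t) t) (cong suc (ℕ.m∸n+n≡m (ℕ.<⇒≤ t<m)))))

-- The defining Pascal rule once, then the mirrored rule on both terms. The middle coefficient
-- arises twice, with weights 1 and q^{(s+2)+(m-s-1)} = q^{m+1}.
qbin-three-term : ∀ m s → qbin (suc (suc m)) (suc (suc s)) ≈
  (one ⊕ qpow (suc m)) ⊛ qbin m (suc s) ⊕
      (qpow (m ∸ s) ⊛ qbin m s ⊕ qpow (suc (suc s)) ⊛ qbin m (suc (suc s)))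
qbin-three-term m s = begin
  qbin (suc m) (suc s) ⊕ Q ⊛ qbin (suc m) (suc (suc s))
    ≈⟨ +-cong (qbin-pascal′ m s) (*-congˡ {Q} (qbin-pascal′ m (suc s))) ⟩
  (A ⊛ qbin m s ⊕ qbin m (suc s)) ⊕ Q ⊛ (B ⊛ qbin m (suc s) ⊕ qbin m (suc (suc s)))
    ≈⟨ solve 6 (λ a b q x y z → (a :* x :+ y) :+ q :* (b :* y :+ z) :=
        q :* (b :* y) :+ (y :+ (a :* x :+ q :* z)))
        ≈-refl A B Q (qbin m s) (qbin m (suc s)) (qbin m (suc (suc s))) ⟩
  Q ⊛ (B ⊛ qbin m (suc s)) ⊕ (qbin m (suc s) ⊕ (A ⊛ qbin m s ⊕ Q ⊛ qbin m (suc (suc s))))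
    ≈⟨ +-congʳ {qbin m (suc s) ⊕ (A ⊛ qbin m s ⊕ Q ⊛ qbin m (suc (suc s)))}
        (qpow-exchange (suc (suc s)) (m ∸ suc s) (suc m) 0 m (suc s) λ s<m →
        trans (cong suc (ℕ.m+[n∸m]≡n s<m)) (sym (ℕ.+-identityʳ (suc m)))) ⟩
  qpow (suc m) ⊛ (one ⊛ qbin m (suc s)) ⊕
      (qbin m (suc s) ⊕ (A ⊛ qbin m s ⊕ Q ⊛ qbin m (suc (suc s))))
    ≈⟨ solve 3 (λ d y r → d :* (con (+ 1) :* y) :+ (y :+ r) := (con (+ 1) :+ d) :* y :+ r)
        ≈-refl (qpow (suc m)) (qbin m (suc s)) (A ⊛ qbin m s ⊕ Q ⊛ qbin m (suc (suc s))) ⟩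
  (one ⊕ qpow (suc m)) ⊛ qbin m (suc s) ⊕ (A ⊛ qbin m s ⊕ Q ⊛ qbin m (suc (suc s))) ∎
  where
  A = qpow (m ∸ s)
  B = qpow (m ∸ suc s)
  Q = qpow (suc (suc s))

qbin-diagonal : ∀ m → qbin m m ≈ one
qbin-diagonal zero    = ≈-refl
qbin-diagonal (suc m) = begin
  qbin m m ⊕ qpow (suc m) ⊛ qbin m (suc m)
    ≈⟨ +-cong (qbin-diagonal m) (*-congˡ {qpow (suc m)} (qbin-above {m} ℕ.≤-refl)) ⟩
  one ⊕ qpow (suc m) ⊛ 0s
    ≈⟨ solve 1 (λ x → con (+ 1) :+ x :* con (+ 0) := con (+ 1)) ≈-refl (qpow (suc m)) ⟩
  one ∎

-- The product formula for the Gaussian binomial, cleared of its denominator. The Pascal rule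
-- reduces (a+1, b+1) to (a, b+1) and (a+1, b).
qbin-poch : ∀ a b → qbin (b ℕ.+ a) a ⊛ poch (qpow 1) b ≈ poch (qpow (suc a)) b
qbin-poch zero    b = *-identityˡ (poch (qpow 1) b)
qbin-poch (suc a) zero = ≈-trans (*-identityʳ (qbin (suc a) (suc a))) (qbin-diagonal (suc a))
qbin-poch (suc a) (suc b) rewrite ℕ.+-suc b a = begin
  (qbin (suc (b ℕ.+ a)) a ⊕ x ⊛ qbin (suc (b ℕ.+ a)) (suc a)) ⊛ (p ⊛ (one ⊖ y))
    ≈⟨ solve 5 (λ u x v p w → (u :+ x :* v) :* (p :* w) := u :* (p :* w) :+ x :* (v :* p) :* w)
        ≈-refl
       (qbin (suc (b ℕ.+ a)) a) x (qbin (suc (b ℕ.+ a)) (suc a)) p (one ⊖ y) ⟩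
  qbin (suc (b ℕ.+ a)) a ⊛ (p ⊛ (one ⊖ y)) ⊕ x ⊛ (qbin (suc (b ℕ.+ a)) (suc a) ⊛ p) ⊛ (one ⊖ y)
    ≈⟨ +-cong (≈-trans (qbin-poch a (suc b)) (poch-qpow-first (suc a) b))
              (*-congʳ {one ⊖ y} (*-congˡ {x} ih)) ⟩
  (one ⊖ x) ⊛ r ⊕ x ⊛ r ⊛ (one ⊖ y)
    -- Here (1-x) + x(1-y) = 1-xy, and xy = q^{a+b+2} supplies the last factor of the target
    -- product.
    ≈⟨ solve 3 (λ x r y → (con (+ 1) :- x) :* r :+ x :* r :* (con (+ 1) :- y) :=
        r :* (con (+ 1) :- x :* y)) ≈-refl x r y ⟩
  r ⊛ (one ⊖ x ⊛ y)
    ≈⟨ *-congˡ {r} (+-congˡ {one} (-‿cong xy≈)) ⟩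
  poch (qpow (suc (suc a))) (suc b) ∎
  where
  x = qpow (suc a)
  y = shift b (qpow 1)
  p = poch (qpow 1) b
  r = poch (qpow (suc (suc a))) b
  ih : qbin (suc (b ℕ.+ a)) (suc a) ⊛ p ≈ r
  ih = subst (λ n → qbin n (suc a) ⊛ p ≈ r) (ℕ.+-suc b a) (qbin-poch (suc a) b)
  xy≈ : x ⊛ y ≈ shift b (qpow (suc (suc a)))
  xy≈ = begin
    x ⊛ shift b (qpow 1)          ≈⟨ *-congˡ {x} (shift-shift b 1 one) ⟩
    x ⊛ qpow (b ℕ.+ 1)            ≈⟨ qpow-+ (suc a) (b ℕ.+ 1) ⟨
    qpow (suc a ℕ.+ (b ℕ.+ 1))    ≈⟨ ≡-qpow (ℕ.+-comm (suc a) (b ℕ.+ 1)) ⟩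
    qpow ((b ℕ.+ 1) ℕ.+ suc a)    ≈⟨ ≡-qpow (ℕ.+-assoc b 1 (suc a)) ⟩
    qpow (b ℕ.+ suc (suc a))      ≈⟨ shift-shift b (suc (suc a)) one ⟨
    shift b (qpow (suc (suc a)))  ∎

-- Coefficients of the finite Jacobi triple product

-- The coefficient of z^k in the finite Jacobi triple product (-zq;q)_n (-1/z;q)_{n+1}.
jacobiCoeff : ℕ → ℕ → FPS
jacobiCoeff n k = qpow (tri k) ⊛ qbin (suc (n ℕ.* 2)) (suc (k ℕ.+ n))

jacobiCoeff-above : ∀ {n k} → n < k → jacobiCoeff n k ≈ 0s
jacobiCoeff-above {n} {k} n<k =
    ≈-trans (*-congˡ {qpow (tri k)}
    (qbin-above (s≤s (subst (_< k ℕ.+ n) 2n≡ (ℕ.+-monoˡ-< n n<k))))) (zeroʳ (qpow (tri k)))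
  where
  2n≡ : n ℕ.+ n ≡ n ℕ.* 2
  2n≡ = sym (trans (ℕ.*-comm n 2) (cong (n ℕ.+_) (ℕ.+-identityʳ n)))

-- Passing from n to n+1 multiplies the triple product by (1 + zD)(1 + D/z) = 1 + D² + D(z + 1/z).
-- In the proof this is `qbin-three-term`, whose weights turn the prefactor q^{tri(k+1)} into D
-- q^{tri k} and D q^{tri(k+2)} at the neighbours.
jacobiCoeff-suc : ∀ n k → let D = qpow (suc n) in
  jacobiCoeff (suc n) (suc k) ≈
  (one ⊕ D ⊛ D) ⊛ jacobiCoeff n (suc k) ⊕ D ⊛ (jacobiCoeff n k ⊕ jacobiCoeff n (suc (suc k)))
jacobiCoeff-suc n k rewrite ℕ.+-suc k n = begin
  T ⊛ qbin (suc (suc m)) (suc (suc s))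
    ≈⟨ *-congˡ {T} (qbin-three-term m s) ⟩
  T ⊛ ((one ⊕ qpow (suc m)) ⊛ qbin m (suc s) ⊕
      (qpow (m ∸ s) ⊛ qbin m s ⊕ qpow (suc (suc s)) ⊛ qbin m (suc (suc s))))
    ≈⟨ solve 7 (λ t d y a x c z → t :* ((con (+ 1) :+ d) :* y :+ (a :* x :+ c :* z)) :=
        (con (+ 1) :+ d) :* (t :* y) :+ (t :* (a :* x) :+ t :* (c :* z))) ≈-refl
        T (qpow (suc m)) (qbin m (suc s)) (qpow (m ∸ s)) (qbin m s) (qpow (suc (suc s)))
            (qbin m (suc (suc s))) ⟩
  (one ⊕ qpow (suc m)) ⊛ (T ⊛ qbin m (suc s)) ⊕
      (T ⊛ (qpow (m ∸ s) ⊛ qbin m s) ⊕ T ⊛ (qpow (suc (suc s)) ⊛ qbin m (suc (suc s))))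
    ≈⟨ +-cong (*-congʳ {T ⊛ qbin m (suc s)}
        (+-congˡ {one} (≈-trans (≡-qpow square) (qpow-+ (suc n) (suc n)))))
              (+-cong (qpow-exchange (tri (suc k)) (m ∸ s) (suc n) (tri k) m s lower)
                      (qpow-exchange (tri (suc k)) (suc (suc s)) (suc n) (tri (suc (suc k))) m
                          (suc (suc s)) upper)) ⟩
  (one ⊕ D ⊛ D) ⊛ (T ⊛ qbin m (suc s)) ⊕
      (D ⊛ (qpow (tri k) ⊛ qbin m s) ⊕ D ⊛ (qpow (tri (suc (suc k))) ⊛ qbin m (suc (suc s))))
    ≈⟨ solve 4 (λ d y x z → y :+ (d :* x :+ d :* z) := y :+ d :* (x :+ z))
        ≈-refl D ((one ⊕ D ⊛ D) ⊛ (T ⊛ qbin m (suc s))) (qpow (tri k) ⊛ qbin m s)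
        (qpow (tri (suc (suc k))) ⊛ qbin m (suc (suc s))) ⟩
  (one ⊕ D ⊛ D) ⊛ jacobiCoeff n (suc k) ⊕ D ⊛ (jacobiCoeff n k ⊕ jacobiCoeff n (suc (suc k))) ∎
  where
  D = qpow (suc n)
  T = qpow (tri (suc k))
  m = suc (n ℕ.* 2)
  s = suc (k ℕ.+ n)
  square : suc m ≡ suc n ℕ.+ suc n
  square = identity n
    where
    identity : ∀ n → suc (suc (n ℕ.* 2)) ≡ suc n ℕ.+ suc n
    identity = NatSolver.solve-∀
  upper : suc (suc s) ≤ m → tri (suc k) ℕ.+ suc (suc s) ≡ suc n ℕ.+ tri (suc (suc k))
  upper _ = identity (tri (suc k)) k n
    where
    identity : ∀ t k n → t ℕ.+ (3 ℕ.+ (k ℕ.+ n)) ≡ suc n ℕ.+ (2 ℕ.+ k ℕ.+ t)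
    identity = NatSolver.solve-∀
  lower : s ≤ m → tri (suc k) ℕ.+ (m ∸ s) ≡ suc n ℕ.+ tri k
  lower (s≤s k+n≤2n) = trans (reorder k (tri k) (n ℕ.* 2 ∸ (k ℕ.+ n)))
    (cong (λ x → suc x ℕ.+ tri k) (ℕ.+-cancelʳ-≡ n _ _
      (trans (ℕ.+-assoc (n ℕ.* 2 ∸ (k ℕ.+ n)) k n)
        (trans (ℕ.m∸n+n≡m k+n≤2n) (double n)))))
    where
    reorder : ∀ k t e → suc k ℕ.+ t ℕ.+ e ≡ suc (e ℕ.+ k) ℕ.+ t
    reorder = NatSolver.solve-∀
    double : ∀ n → n ℕ.* 2 ≡ n ℕ.+ n
    double = NatSolver.solve-∀

-- The weighted sum and its recurrence

sumFPS : ℕ → (ℕ → FPS) → FPS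
sumFPS n F m = sumUpTo n (λ k → F k m)

⊛-sumFPS : ∀ n f F → f ⊛ sumFPS n F ≈ sumFPS n (λ k → f ⊛ F k)
⊛-sumFPS zero    f F = ≈-refl
⊛-sumFPS (suc n) f F = ≈-trans (distribˡ f (sumFPS n F) (F (suc n)))
    (+-congʳ {f ⊛ F (suc n)} (⊛-sumFPS n f F))

-- The cut-off `K` is separate from `n` so that the recurrence in `n` can be proved by induction on
-- `K`.
weightedSum : ℕ → ℕ → FPS
weightedSum n K = sumFPS K (λ k → const (+ k) ⊛ jacobiCoeff n k)

const-convex : ∀ k → const (+ k) ⊕ const (+ (2 ℕ.+ k)) ≈ const (+ suc k) ⊕ const (+ suc k)
const-convex k = begin
  const (+ k) ⊕ const (+ (2 ℕ.+ k))  ≈⟨ +-homo (+ k) (+ (2 ℕ.+ k)) ⟨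
  const (+ (k ℕ.+ (2 ℕ.+ k)))        ≈⟨ ≈-reflexive
      (cong (λ j → const (+ j)) (ℕ.+-suc k (suc k))) ⟩
  const (+ (suc k ℕ.+ suc k))        ≈⟨ +-homo (+ suc k) (+ suc k) ⟩
  const (+ suc k) ⊕ const (+ suc k)  ∎
  where open _-Raw-AlmostCommutative⟶_ const-homomorphism using (+-homo)

-- Summing `jacobiCoeff-suc` with weights k gives an inner `a j` the factor j(1 + D²) + D((j-1) +
-- (j+1)) = j(1+D)². The cut-off leaves three boundary terms: `a 0`, the share that `a K` lacks, and
-- the excess at `a (suc K)`. The missing share stands on the left to avoid subtraction.
weightedSum-suc : ∀ n K → let D = qpow (suc n); a = jacobiCoeff n in
  weightedSum (suc n) K ⊕ D ⊛ (const (+ suc K) ⊛ a K) ≈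
  (one ⊕ D) ⊛ (one ⊕ D) ⊛ weightedSum n K ⊕ D ⊛ a 0 ⊕ D ⊛ (const (+ K) ⊛ a (suc K))
weightedSum-suc n zero =
  solve 4 (λ D a a₁ b → con (+ 0) :* b :+ D :* (con (+ 1) :* a) :=
      (con (+ 1) :+ D) :* (con (+ 1) :+ D) :* (con (+ 0) :* a) :+ D :* a :+
          D :* (con (+ 0) :* a₁)) ≈-refl
    (qpow (suc n)) (jacobiCoeff n 0) (jacobiCoeff n 1) (jacobiCoeff (suc n) 0)
weightedSum-suc n (suc K) = begin
  Z′ ⊕ x₁ ⊛ jacobiCoeff (suc n) (suc K) ⊕ D ⊛ (x₂ ⊛ v)
    ≈⟨ +-congʳ {D ⊛ (x₂ ⊛ v)} (+-congˡ {Z′} (*-congˡ {x₁} (jacobiCoeff-suc n K))) ⟩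
  Z′ ⊕ x₁ ⊛ ((one ⊕ D ⊛ D) ⊛ v ⊕ D ⊛ (u ⊕ w)) ⊕ D ⊛ (x₂ ⊛ v)
    -- The part D(K+1)u of the new summand is the boundary term on the left of the induction
    -- hypothesis.
    ≈⟨ solve 7 (λ Z′ x₁ x₂ D u v w →
          Z′ :+ x₁ :* ((con (+ 1) :+ D :* D) :* v :+ D :* (u :+ w)) :+ D :* (x₂ :* v) :=
          (Z′ :+ D :* (x₁ :* u)) :+ (x₁ :* ((con (+ 1) :+ D :* D) :* v :+ D :* w) :+
              D :* (x₂ :* v)))
        ≈-refl Z′ x₁ x₂ D u v w ⟩
  (Z′ ⊕ D ⊛ (x₁ ⊛ u)) ⊕ (x₁ ⊛ ((one ⊕ D ⊛ D) ⊛ v ⊕ D ⊛ w) ⊕ D ⊛ (x₂ ⊛ v))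
    ≈⟨ +-congʳ {x₁ ⊛ ((one ⊕ D ⊛ D) ⊛ v ⊕ D ⊛ w) ⊕ D ⊛ (x₂ ⊛ v)} (weightedSum-suc n K) ⟩
  ((one ⊕ D) ⊛ (one ⊕ D) ⊛ Z ⊕ D ⊛ b ⊕ D ⊛ (x ⊛ v)) ⊕
      (x₁ ⊛ ((one ⊕ D ⊛ D) ⊛ v ⊕ D ⊛ w) ⊕ D ⊛ (x₂ ⊛ v))
    ≈⟨ solve 8 (λ Z x x₁ x₂ D b v w →
          ((con (+ 1) :+ D) :* (con (+ 1) :+ D) :* Z :+ D :* b :+ D :* (x :* v)) :+
              (x₁ :* ((con (+ 1) :+ D :* D) :* v :+ D :* w) :+ D :* (x₂ :* v)) :=
          D :* v :* (x :+ x₂) :+ ((con (+ 1) :+ D) :* (con (+ 1) :+ D) :* Z :+ D :* b :+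
              x₁ :* ((con (+ 1) :+ D :* D) :* v :+ D :* w)))
        ≈-refl Z x x₁ x₂ D b v w ⟩
  D ⊛ v ⊛ (x ⊕ x₂) ⊕ ((one ⊕ D) ⊛ (one ⊕ D) ⊛ Z ⊕ D ⊛ b ⊕ x₁ ⊛ ((one ⊕ D ⊛ D) ⊛ v ⊕ D ⊛ w))
    -- The weight K left by the induction hypothesis and the new boundary weight K+2 add up to
    -- 2(K+1), which completes 1 + D² to (1+D)² at `v`.
    ≈⟨ +-congʳ {(one ⊕ D) ⊛ (one ⊕ D) ⊛ Z ⊕ D ⊛ b ⊕ x₁ ⊛ ((one ⊕ D ⊛ D) ⊛ v ⊕ D ⊛ w)}
         (*-congˡ {D ⊛ v} (const-convex K)) ⟩
  D ⊛ v ⊛ (x₁ ⊕ x₁) ⊕ ((one ⊕ D) ⊛ (one ⊕ D) ⊛ Z ⊕ D ⊛ b ⊕ x₁ ⊛ ((one ⊕ D ⊛ D) ⊛ v ⊕ D ⊛ w))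
    ≈⟨ solve 6 (λ Z x₁ D b v w →
          D :* v :* (x₁ :+ x₁) :+ ((con (+ 1) :+ D) :* (con (+ 1) :+ D) :* Z :+ D :* b :+
              x₁ :* ((con (+ 1) :+ D :* D) :* v :+ D :* w)) :=
          (con (+ 1) :+ D) :* (con (+ 1) :+ D) :* (Z :+ x₁ :* v) :+ D :* b :+ D :* (x₁ :* w))
        ≈-refl Z x₁ D b v w ⟩
  (one ⊕ D) ⊛ (one ⊕ D) ⊛ (Z ⊕ x₁ ⊛ v) ⊕ D ⊛ b ⊕ D ⊛ (x₁ ⊛ w) ∎
  where
  D  = qpow (suc n)
  x  = const (+ K)
  x₁ = const (+ suc K)
  x₂ = const (+ suc (suc K))
  b  = jacobiCoeff n 0
  u  = jacobiCoeff n K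
  v  = jacobiCoeff n (suc K)
  w  = jacobiCoeff n (suc (suc K))
  Z  = weightedSum n K
  Z′ = weightedSum (suc n) K

-- At cut-off n+1 every upper boundary term contains `jacobiCoeff n` at an index above n, hence
-- vanishes.
weightedSum-diagonal : ∀ n → let D = qpow (suc n) in
  weightedSum (suc n) (suc n) ≈ (one ⊕ D) ⊛ (one ⊕ D) ⊛ weightedSum n n ⊕ D ⊛ jacobiCoeff n 0
weightedSum-diagonal n = begin
  Z′
    ≈⟨ solve 3 (λ Z′ D y → Z′ := Z′ :+ D :* (y :* con (+ 0))) ≈-refl Z′ D y ⟩
  Z′ ⊕ D ⊛ (y ⊛ 0s)
    ≈⟨ +-congˡ {Z′} (*-congˡ {D} (*-congˡ {y} v≈0)) ⟨
  Z′ ⊕ D ⊛ (y ⊛ jacobiCoeff n (suc n))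
    ≈⟨ weightedSum-suc n (suc n) ⟩
  (one ⊕ D) ⊛ (one ⊕ D) ⊛ (Z ⊕ x ⊛ jacobiCoeff n (suc n)) ⊕ D ⊛ b ⊕
      D ⊛ (x ⊛ jacobiCoeff n (suc (suc n)))
    ≈⟨ +-cong (+-congʳ {D ⊛ b} (*-congˡ {(one ⊕ D) ⊛ (one ⊕ D)} (+-congˡ {Z} (*-congˡ {x} v≈0))))
              (*-congˡ {D} (*-congˡ {x} (jacobiCoeff-above (ℕ.m≤n⇒m≤1+n ℕ.≤-refl)))) ⟩
  (one ⊕ D) ⊛ (one ⊕ D) ⊛ (Z ⊕ x ⊛ 0s) ⊕ D ⊛ b ⊕ D ⊛ (x ⊛ 0s)
    ≈⟨ solve 4 (λ Z x D b → (con (+ 1) :+ D) :* (con (+ 1) :+ D) :* (Z :+ x :* con (+ 0)) :+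
        D :* b :+ D :* (x :* con (+ 0)) :=
                 (con (+ 1) :+ D) :* (con (+ 1) :+ D) :* Z :+ D :* b) ≈-refl Z x D b ⟩
  (one ⊕ D) ⊛ (one ⊕ D) ⊛ Z ⊕ D ⊛ b ∎
  where
  D  = qpow (suc n)
  x  = const (+ suc n)
  y  = const (+ suc (suc n))
  b  = jacobiCoeff n 0
  Z  = weightedSum n n
  Z′ = weightedSum (suc n) (suc n)
  v≈0 : jacobiCoeff n (suc n) ≈ 0s
  v≈0 = jacobiCoeff-above {n} ℕ.≤-refl

-- Identifies the k = 0 boundary term with the Pochhammer factor of the new summand: `qbin-poch`
-- gives (q^{n+2};q)_n, and 1 - q^{n+1} is the missing first factor.
poch-jacobiCoeff-0 : ∀ n →
  (one ⊖ qpow (suc n)) ⊛ (poch (qpow 1) n ⊛ jacobiCoeff n 0) ≈ poch (qpow (suc n)) (suc n)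
poch-jacobiCoeff-0 n = begin
  (one ⊖ qpow (suc n)) ⊛ (poch (qpow 1) n ⊛ (one ⊛ qbin (suc (n ℕ.* 2)) (suc n)))
    ≈⟨ *-congˡ {one ⊖ qpow (suc n)}
        (solve 2 (λ p x → p :* (con (+ 1) :* x) := x :* p)
            ≈-refl (poch (qpow 1) n) (qbin (suc (n ℕ.* 2)) (suc n))) ⟩
  (one ⊖ qpow (suc n)) ⊛ (qbin (suc (n ℕ.* 2)) (suc n) ⊛ poch (qpow 1) n)
    ≈⟨ *-congˡ {one ⊖ qpow (suc n)}
        (*-congʳ {poch (qpow 1) n} (≈-reflexive (cong (λ j → qbin j (suc n)) (identity n)))) ⟩
  (one ⊖ qpow (suc n)) ⊛ (qbin (n ℕ.+ suc n) (suc n) ⊛ poch (qpow 1) n)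
    ≈⟨ *-congˡ {one ⊖ qpow (suc n)} (qbin-poch (suc n) n) ⟩
  (one ⊖ qpow (suc n)) ⊛ poch (qpow (suc (suc n))) n
    ≈⟨ poch-qpow-first (suc n) n ⟨
  poch (qpow (suc n)) (suc n) ∎
  where
  identity : ∀ n → suc (n ℕ.* 2) ≡ n ℕ.+ suc n
  identity = NatSolver.solve-∀

-- Closed form of the partial sums

-- S_n, with the passage from n to n+1 adjoining the factors at q^{n+1}.
partialSum : ℕ → FPS
partialSum zero    = 0s
partialSum (suc n) = (one ⊖ D) ⊛ ((one ⊕ D) ⊛ (one ⊕ D)) ⊛ partialSum n ⊕ D ⊛ poch D (suc n)
  where D = qpow (suc n)

partialSum-closed : ∀ n → partialSum n ≈ poch (qpow 1) n ⊛ weightedSum n n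
partialSum-closed zero = solve 1 (λ x → con (+ 0) := con (+ 1) :* (con (+ 0) :* x))
    ≈-refl (jacobiCoeff 0 0)
partialSum-closed (suc n) = begin
  (one ⊖ D) ⊛ ((one ⊕ D) ⊛ (one ⊕ D)) ⊛ partialSum n ⊕ D ⊛ poch D (suc n)
    ≈⟨ +-cong (*-congˡ {(one ⊖ D) ⊛ ((one ⊕ D) ⊛ (one ⊕ D))} (partialSum-closed n))
              (*-congˡ {D} (≈-sym (poch-jacobiCoeff-0 n))) ⟩
  (one ⊖ D) ⊛ ((one ⊕ D) ⊛ (one ⊕ D)) ⊛ (p ⊛ Z) ⊕ D ⊛ ((one ⊖ D) ⊛ (p ⊛ b))
    ≈⟨ solve 4 (λ D p Z b →
          (con (+ 1) :- D) :* ((con (+ 1) :+ D) :* (con (+ 1) :+ D)) :* (p :* Z) :+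
        D :* ((con (+ 1) :- D) :* (p :* b)) :=
          p :* (con (+ 1) :- D) :* ((con (+ 1) :+ D) :* (con (+ 1) :+ D) :* Z :+ D :* b))
              ≈-refl D p Z b ⟩
  p ⊛ (one ⊖ D) ⊛ ((one ⊕ D) ⊛ (one ⊕ D) ⊛ Z ⊕ D ⊛ b)
    ≈⟨ ⊛-cong (*-congˡ {p} (+-congˡ {one} (-‿cong D≈))) (≈-sym (weightedSum-diagonal n)) ⟩
  poch (qpow 1) (suc n) ⊛ weightedSum (suc n) (suc n) ∎
  where
  D = qpow (suc n)
  p = poch (qpow 1) n
  b = jacobiCoeff n 0
  Z = weightedSum n n
  D≈ : D ≈ shift n (qpow 1)
  D≈ = ≈-trans (≡-qpow (ℕ.+-comm 1 n)) (≈-sym (shift-shift n 1 one))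

-- Tails of the infinite products

tail : ℕ → FPS
tail n = pochInf (neg (qpow (suc n))) ⊛ pochInf (neg (qpow (suc n))) ⊛ pochInf (qpow (suc n))

tail-first : ∀ n → let D = qpow (suc n) in
  tail n ≈ (one ⊖ D) ⊛ ((one ⊕ D) ⊛ (one ⊕ D)) ⊛ tail (suc n)
tail-first n = begin
  pochInf (neg D) ⊛ pochInf (neg D) ⊛ pochInf D
    ≈⟨ ⊛-cong (⊛-cong minus minus) plus ⟩
  (one ⊖ neg D) ⊛ P ⊛ ((one ⊖ neg D) ⊛ P) ⊛ ((one ⊖ D) ⊛ Q)
    ≈⟨ solve 3 (λ D P Q →
          (con (+ 1) :- (:- D)) :* P :* ((con (+ 1) :- (:- D)) :* P) :* ((con (+ 1) :- D) :* Q) :=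
          (con (+ 1) :- D) :* ((con (+ 1) :+ D) :* (con (+ 1) :+ D)) :* (P :* P :* Q))
              ≈-refl D P Q ⟩
  (one ⊖ D) ⊛ ((one ⊕ D) ⊛ (one ⊕ D)) ⊛ tail (suc n) ∎
  where
  D = qpow (suc n)
  P = pochInf (neg (qpow (suc (suc n))))
  Q = pochInf (qpow (suc (suc n)))
  plus : pochInf D ≈ (one ⊖ D) ⊛ Q
  plus = ≈-trans (pochInf-first D) (*-congˡ {one ⊖ D} (pochInf-cong (shift-shift 1 (suc n) one)))
  minus : pochInf (neg D) ≈ (one ⊖ neg D) ⊛ P
  minus = ≈-trans (pochInf-first (neg D)) (*-congˡ {one ⊖ neg D}
    (pochInf-cong (≈-trans (shift-neg 1 D) (-‿cong (shift-shift 1 (suc n) one)))))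

tail-one : ∀ n → tail n ≈[ suc n ] one
tail-one n = ⊛-one (⊛-one minus minus) (pochInf-one small)
  where
  small : qpow (suc n) ≈[ suc n ] 0s
  small = shift-small (suc n) one
  minus : pochInf (neg (qpow (suc n))) ≈[ suc n ] one
  minus = pochInf-one (below λ m m<n → cong -_ (coeff< small m m<n))

-- An exact identity. Extracting the common tail at each new index releases the factor (1-D)(1+D)²
-- of `tail-first`, the multiplier in the recursion of `partialSum`.
sum-lhsTerm : ∀ n → sumFPS n (lhsTerm ∘ suc) ≈ partialSum (suc n) ⊛ tail (suc n)
sum-lhsTerm zero = solve 5 (λ D P Q r y → D :* P :* P :* Q :* r :=
    (y :* con (+ 0) :+ D :* r) :* (P :* P :* Q))
  ≈-refl (qpow 1) (pochInf (neg (qpow 2))) (pochInf (qpow 2)) (poch (qpow 1) 1)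
  ((one ⊖ qpow 1) ⊛ ((one ⊕ qpow 1) ⊛ (one ⊕ qpow 1)))
sum-lhsTerm (suc n) = begin
  sumFPS n (lhsTerm ∘ suc) ⊕ lhsTerm (suc (suc n))
    ≈⟨ +-congʳ {lhsTerm (suc (suc n))}
        (≈-trans (sum-lhsTerm n) (*-congˡ {partialSum (suc n)} (tail-first (suc n)))) ⟩
  partialSum (suc n) ⊛ (E ⊛ (P ⊛ P ⊛ Q)) ⊕ D ⊛ P ⊛ P ⊛ Q ⊛ r
    ≈⟨ solve 6 (λ s E P Q D r → s :* (E :* (P :* P :* Q)) :+ D :* P :* P :* Q :* r :=
        (E :* s :+ D :* r) :* (P :* P :* Q))
        ≈-refl (partialSum (suc n)) E P Q D r ⟩
  partialSum (suc (suc n)) ⊛ tail (suc (suc n)) ∎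
  where
  D = qpow (suc (suc n))
  E = (one ⊖ D) ⊛ ((one ⊕ D) ⊛ (one ⊕ D))
  P = pochInf (neg (qpow (suc (suc (suc n)))))
  Q = pochInf (qpow (suc (suc (suc n))))
  r = poch D (suc (suc n))

-- Passage to the limit

-- With b = n-k, splitting (q;q)_n as (q;q)_b (q^{b+1};q)_k lets `qbin-poch` absorb the first part.
-- What remains is 1 modulo q^{b+1}, and the prefactor q^{tri k} raises the modulus to at least
-- q^{n+1} because tri k ≥ k.
poch-jacobiCoeff : ∀ {n k} → k ≤ n → poch (qpow 1) n ⊛ jacobiCoeff n k ≈[ suc n ] qpow (tri k)
poch-jacobiCoeff {n} {k} k≤n = ≈[]-weaken bound
  (≈[]-trans (≈⇒≈[] factor) (shift-congᵐ (tri k) (⊛-one (poch-one b lemma₁) (poch-one k lemma₂))))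
  where
  b = n ∸ k
  s = suc (k ℕ.+ n)
  k≤tri : ∀ k → k ≤ tri k
  k≤tri zero    = z≤n
  k≤tri (suc k) = ℕ.m≤m+n (suc k) (tri k)
  bound : suc n ≤ tri k ℕ.+ suc b
  bound = subst (_≤ tri k ℕ.+ suc b) (trans (ℕ.+-suc k b) (cong suc (ℕ.m+[n∸m]≡n k≤n)))
      (ℕ.+-monoˡ-≤ (suc b) (k≤tri k))
  lemma₁ : qpow (suc s) ≈[ suc b ] 0s
  lemma₁ = ≈[]-weaken (s≤s (ℕ.≤-trans (ℕ.m∸n≤m n k) (ℕ.m≤n⇒m≤1+n (ℕ.m≤n+m n k))))
      (shift-small (suc s) one)
  lemma₂ : shift b (qpow 1) ≈[ suc b ] 0s
  lemma₂ = ≈[]-trans (≈⇒≈[] (≈-trans (shift-shift b 1 one) (≡-qpow (ℕ.+-comm b 1))))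
      (shift-small (suc b) one)
  top : suc (n ℕ.* 2) ≡ b ℕ.+ s
  top = sym (trans (ℕ.+-suc b (k ℕ.+ n)) (cong suc (trans (sym (ℕ.+-assoc b k n))
    (trans (cong (ℕ._+ n) (ℕ.m∸n+n≡m k≤n)) (identity n)))))
    where
    identity : ∀ n → n ℕ.+ n ≡ n ℕ.* 2
    identity = NatSolver.solve-∀
  factor : poch (qpow 1) n ⊛ jacobiCoeff n k ≈
      shift (tri k) (poch (qpow (suc s)) b ⊛ poch (shift b (qpow 1)) k)
  factor = begin
    poch (qpow 1) n ⊛ (qpow (tri k) ⊛ qbin (suc (n ℕ.* 2)) s)
      ≈⟨ ⊛-cong (≈-reflexive (cong (poch (qpow 1)) (sym (ℕ.m∸n+n≡m k≤n))))
                (*-congˡ {qpow (tri k)} (≈-reflexive (cong (λ j → qbin j s) top))) ⟩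
    poch (qpow 1) (b ℕ.+ k) ⊛ (qpow (tri k) ⊛ qbin (b ℕ.+ s) s)
      ≈⟨ *-congʳ {qpow (tri k) ⊛ qbin (b ℕ.+ s) s} (poch-+ (qpow 1) b k) ⟩
    poch (qpow 1) b ⊛ c ⊛ (qpow (tri k) ⊛ qbin (b ℕ.+ s) s)
      ≈⟨ solve 4 (λ p c t x → p :* c :* (t :* x) := t :* (x :* p :* c))
          ≈-refl (poch (qpow 1) b) c (qpow (tri k)) (qbin (b ℕ.+ s) s) ⟩
    qpow (tri k) ⊛ (qbin (b ℕ.+ s) s ⊛ poch (qpow 1) b ⊛ c)
      ≈⟨ *-congˡ {qpow (tri k)} (*-congʳ {c} (qbin-poch s b)) ⟩
    qpow (tri k) ⊛ (poch (qpow (suc s)) b ⊛ c)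
      ≈⟨ qpow⊛ (tri k) (poch (qpow (suc s)) b ⊛ c) ⟩
    shift (tri k) (poch (qpow (suc s)) b ⊛ c) ∎
    where c = poch (shift b (qpow 1)) k

sumFPS-congᵐ : ∀ n {d F G} → (∀ k → k ≤ n → F k ≈[ d ] G k) → sumFPS n F ≈[ d ] sumFPS n G
sumFPS-congᵐ n p = below λ m m<d → sumUpTo-cong n λ k k≤n → coeff< (p k k≤n) m m<d

poch-weightedSum : ∀ n → poch (qpow 1) n ⊛ weightedSum n n ≈[ suc n ] sumFPS n (λ k →
    (+ k) • qpow (tri k))
poch-weightedSum n = ≈[]-trans (≈⇒≈[] (⊛-sumFPS n p (λ k → const (+ k) ⊛ jacobiCoeff n k)))
    (sumFPS-congᵐ n λ k k≤n →
  ≈[]-trans (≈⇒≈[] (solve 3 (λ p x c → p :* (x :* c) := x :* (p :* c))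
      ≈-refl p (const (+ k)) (jacobiCoeff n k)))
  (≈[]-trans (⊛-congˡᵐ (const (+ k)) (poch-jacobiCoeff k≤n))
             (≈⇒≈[] (const⊛ (+ k) (qpow (tri k))))))
  where p = poch (qpow 1) n

theorem1p3 : (m : ℕ) → sumInf lhsTerm m ≡ rhsSeries m
theorem1p3 m = R.begin
  sumInf lhsTerm m
    -- At coefficient m, `sumInf` adds the summands 1 to m+1, which is why the partial sum has index
    -- m+1.
    R.≡⟨ coeff (sum-lhsTerm m) m ⟩
  (partialSum (suc m) ⊛ tail (suc m)) m
    R.≡⟨ coeff< (⊛-congˡᵐ (partialSum (suc m)) (tail-one (suc m))) m m<2+m ⟩
  (partialSum (suc m) ⊛ one) m
    R.≡⟨ coeff (≈-trans (*-identityʳ (partialSum (suc m))) (partialSum-closed (suc m))) m ⟩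
  (poch (qpow 1) (suc m) ⊛ weightedSum (suc m) (suc m)) m
    R.≡⟨ coeff< (poch-weightedSum (suc m)) m m<2+m ⟩
  sumUpTo (suc m) (λ k → + k * qpow (tri k) m)
    -- The closed form starts at k = 0 and `rhsSeries` at 1; the extra term has weight 0.
    R.≡⟨ sumUpTo-first m (λ k → + k * qpow (tri k) m) ⟩
  + 0 + rhsSeries m
    R.≡⟨ ℤ.+-identityˡ (rhsSeries m) ⟩
  rhsSeries m R.∎
  where
  module R = ≡-Reasoning
  m<2+m : m < suc (suc m)
  m<2+m = s≤s (ℕ.n≤1+n m)
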